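{- Let $n=pqrd$ where $p,q$ are two distinct primes and $r,d>1$ are integers. Then there exist $E,F\subseteq\mathbb{Z}_n$ which are not translates of each other but have the same $3$-deck.
   Context: For $f:\mathbb{Z}_n\to\mathbb{R}$, the $3$-deck is $N_{f,3}(x_1,x_2)=\sum_{x\in\mathbb{Z}_n} f(x)f(x+x_1)f(x+x_2)$ for $x_1,x_2\in\mathbb{Z}_n$; the $3$-deck of $E\subseteq\mathbb{Z}_n$ is that of its indicator function. $E$ and $F$ are translates of each other if $F=E+t$ for some $t\in\mathbb{Z}_n$. -}

module Defs where

open import Data.Nat using (ℕ; suc; _+_; _*_)
open import Data.Nat.DivMod using (_mod_)
open import Data.Fin using (Fin; toℕ)
open import Data.Bool using (Bool; true; false)
open import Data.Vec.Functional using (Vector)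
open import Data.Vec.Base using (sum; tabulate)
open import Relation.Binary.PropositionalEquality using (_≡_)

-- ℤ_n with n = suc m (so n ≥ 1), represented by Fin (suc m).
-- Addition modulo n.
_⊕_ : {m : ℕ} → Fin (suc m) → Fin (suc m) → Fin (suc m)
_⊕_ {m} a b = (toℕ a + toℕ b) mod (suc m)

Subsetℤ : ℕ → Set
Subsetℤ m = Fin (suc m) → Bool

𝟙 : {m : ℕ} → Subsetℤ m → Fin (suc m) → ℕ
𝟙 E x with E x
... | true  = 1
... | false = 0

Σℤ : {m : ℕ} → (Fin (suc m) → ℕ) → ℕ
Σℤ f = sum (tabulate f)

deck3 : {m : ℕ} → (Fin (suc m) → ℕ) → Fin (suc m) → Fin (suc m) → ℕ
deck3 f x₁ x₂ = Σℤ (λ x → f x * f (x ⊕ x₁) * f (x ⊕ x₂))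

SameDeck3 : {m : ℕ} → Subsetℤ m → Subsetℤ m → Set
SameDeck3 E F = ∀ x₁ x₂ → deck3 (𝟙 E) x₁ x₂ ≡ deck3 (𝟙 F) x₁ x₂

-- F = E + t, i.e. y ∈ F ⟺ y - t ∈ E; equivalently x ∈ E ⟺ x + t ∈ F for all x.
IsTranslate : {m : ℕ} → Subsetℤ m → Subsetℤ m → Set
IsTranslate {m} E F = Σ' (Fin (suc m)) (λ t → ∀ x → F (x ⊕ t) ≡ E x)
  where
  open import Data.Product using () renaming (Σ to Σ')

{-# OPTIONS --safe #-}
module Submission where

-- Put M = r d and W_k = { - j d : j < r } + k M ℤ. The sets are E = W_q ∪ (W_p - 1) and
-- F = W_q ∪ (W_p - 1 - d). In the expansion of the deck of E, each mixed term pairs one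
-- progression with a function whose period is that of the other. Against a q M-periodic
-- function, shifting W_p by d changes only the term j = 0 to j = r, a shift by M, which is
-- invisible because p and q are coprime; likewise with p and q exchanged. So the deck is
-- unchanged. The two sets are not translates because the places where a progression stops
-- recover k M ℤ.

open import Defs
open import Data.Nat using (ℕ; suc; _*_; _<_)
open import Data.Nat.Primality using (Prime)
open import Data.Product using (Σ; _×_)
open import Relation.Binary.PropositionalEquality using (_≡_; _≢_)
open import Relation.Nullary using (¬_)
open import Data.Bool using (true; false; if_then_else_)
open import Data.Fin using (Fin; zero; suc; toℕ)
open import Data.Fin.Properties using (toℕ-fromℕ<)
open import Data.Nat using (zero; _+_; _≤_; z≤n; s≤s; NonZero; >-nonZero; nonTrivial⇒n>1; _%_; _/_)
open import Data.Nat.Coprimality using (Coprime; coprime-Bézout)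
import Data.Nat.Coprimality as Coprime
open import Data.Nat.DivMod using (_mod_; m≡m%n+[m/n]*n)
open import Data.Nat.Divisibility
open import Data.Nat.GCD using (module Bézout)
open import Data.Nat.Primality using (prime⇒irreducible; prime⇒nonTrivial)
open import Data.Nat.Properties
open import Data.Nat.Tactic.RingSolver using (solve-∀)
open import Data.Product using (_,_; proj₁; proj₂)
open import Data.Sum using (inj₁; inj₂)
open import Data.Vec.Base using (sum; tabulate)
open import Function using (_∘_)
open import Relation.Binary.PropositionalEquality
  using (refl; sym; trans; cong; cong₂; subst; module ≡-Reasoning)
open import Relation.Nullary using (yes; no; does; contradiction)

open ≡-Reasoning

-- Finite sums of functions on the natural numbers.

∑ : ℕ → (ℕ → ℕ) → ℕ
∑ zero    f = 0
∑ (suc n) f = f 0 + ∑ n (f ∘ suc)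

∑-cong : ∀ n {f g : ℕ → ℕ} → (∀ x → f x ≡ g x) → ∑ n f ≡ ∑ n g
∑-cong zero    f≗g = refl
∑-cong (suc n) f≗g = cong₂ _+_ (f≗g 0) (∑-cong n (f≗g ∘ suc))

∑-+ : ∀ n (f g : ℕ → ℕ) → ∑ n (λ x → f x + g x) ≡ ∑ n f + ∑ n g
∑-+ zero    f g = refl
∑-+ (suc n) f g = begin
  f 0 + g 0 + ∑ n (λ x → f (suc x) + g (suc x))       ≡⟨ cong (f 0 + g 0 +_) (∑-+ n (f ∘ suc) (g ∘ suc)) ⟩
  f 0 + g 0 + (∑ n (f ∘ suc) + ∑ n (g ∘ suc))         ≡⟨ interchange (f 0) (g 0) _ _ ⟩
  f 0 + ∑ n (f ∘ suc) + (g 0 + ∑ n (g ∘ suc))         ∎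
  where
  interchange : ∀ a b c d → a + b + (c + d) ≡ a + c + (b + d)
  interchange = solve-∀

∑-snoc : ∀ n (f : ℕ → ℕ) → f 0 + ∑ n (f ∘ suc) ≡ ∑ n f + f n
∑-snoc zero    f = +-identityʳ (f 0)
∑-snoc (suc n) f = trans (cong (f 0 +_) (∑-snoc n (f ∘ suc))) (sym (+-assoc (f 0) _ _))

∑-tabulate : ∀ n (f : ℕ → ℕ) (g : Fin n → ℕ) → (∀ i → g i ≡ f (toℕ i)) → sum (tabulate g) ≡ ∑ n f
∑-tabulate zero    f g eq = refl
∑-tabulate (suc n) f g eq = cong₂ _+_ (eq zero) (∑-tabulate n (f ∘ suc) (g ∘ suc) (eq ∘ suc))

-- Periodic functions and translation invariance of their sums.

Periodic : ℕ → (ℕ → ℕ) → Set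
Periodic N f = ∀ x → f (N + x) ≡ f x

swap-+ : ∀ a b c → a + (b + c) ≡ b + (a + c)
swap-+ = solve-∀

periodic-shift : ∀ {N f} u → Periodic N f → Periodic N (λ x → f (u + x))
periodic-shift {N} {f} u per x = trans (cong f (swap-+ u N x)) (per (u + x))

periodic-+ : ∀ {N f g} → Periodic N f → Periodic N g → Periodic N (λ x → f x + g x)
periodic-+ pf pg x = cong₂ _+_ (pf x) (pg x)

periodic-* : ∀ {N f g} → Periodic N f → Periodic N g → Periodic N (λ x → f x * g x)
periodic-* pf pg x = cong₂ _*_ (pf x) (pg x)

periodic-multiple : ∀ {N f} k → Periodic N f → Periodic (k * N) f
periodic-multiple         zero    per x = refl
periodic-multiple {N} {f} (suc k) per x = begin
  f (N + k * N + x)    ≡⟨ cong f (+-assoc N (k * N) x) ⟩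
  f (N + (k * N + x))  ≡⟨ per (k * N + x) ⟩
  f (k * N + x)        ≡⟨ periodic-multiple k per x ⟩
  f x                  ∎

periodic-∣ : ∀ {N n f} → N ∣ n → Periodic N f → Periodic n f
periodic-∣ (divides-refl k) = periodic-multiple k

periodic-% : ∀ {n} .{{_ : NonZero n}} {f} → Periodic n f → ∀ x → f (x % n) ≡ f x
periodic-% {n} {f} per x = begin
  f (x % n)                ≡⟨ periodic-multiple (x / n) per (x % n) ⟨
  f (x / n * n + x % n)    ≡⟨ cong f (+-comm (x / n * n) (x % n)) ⟩
  f (x % n + x / n * n)    ≡⟨ cong f (m≡m%n+[m/n]*n x n) ⟨
  f x                      ∎

-- Moving the window by one place drops `f (c + 0)` in front and gains `f (c + n)` at the end, which
-- periodicity makes equal. That value is added to both sides and cancelled, so that no subtraction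
-- occurs in ℕ.
∑-shift : ∀ {n f} → Periodic n f → ∀ c → ∑ n (λ x → f (c + x)) ≡ ∑ n f
∑-shift         per zero    = refl
∑-shift {n} {f} per (suc c) = trans (+-cancelˡ-≡ (f (c + 0)) _ _ (begin
  f (c + 0) + ∑ n (λ x → f (suc c + x))  ≡⟨ cong (f (c + 0) +_) (∑-cong n (λ x → cong f (sym (+-suc c x)))) ⟩
  f (c + 0) + ∑ n (λ x → f (c + suc x))  ≡⟨ ∑-snoc n (λ x → f (c + x)) ⟩
  ∑ n (λ x → f (c + x)) + f (c + n)      ≡⟨ cong₂ _+_ refl (trans (cong f (+-comm c n)) (trans (per c) (cong f (sym (+-identityʳ c))))) ⟩
  ∑ n (λ x → f (c + x)) + f (c + 0)      ≡⟨ +-comm _ (f (c + 0)) ⟩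
  f (c + 0) + ∑ n (λ x → f (c + x))      ∎)) (∑-shift per c)

-- By Bézout, shifting both factors by a multiple of q M amounts to shifting φ alone by ± M.
∑-coprime-shift : ∀ {p q} M {n h φ} → Coprime p q → p * M ∣ n → q * M ∣ n →
                  Periodic (q * M) h → Periodic (p * M) φ →
                  ∑ n (λ x → h x * φ x) ≡ ∑ n (λ x → h x * φ (M + x))
∑-coprime-shift {p} {q} M {n} {h} {φ} cop pM∣n qM∣n perh perφ with coprime-Bézout cop
... | Bézout.-+ b a 1+bp≡aq = begin
  ∑ n (λ x → h x * φ x)                              ≡⟨ ∑-shift (periodic-* (periodic-∣ qM∣n perh) (periodic-∣ pM∣n perφ)) (a * (q * M)) ⟨
  ∑ n (λ x → h (a * (q * M) + x) * φ (a * (q * M) + x))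
    ≡⟨ ∑-cong n (λ x → cong₂ _*_ (periodic-multiple a perh x) (trans (cong φ (regroup x)) (periodic-multiple b perφ (M + x)))) ⟩
  ∑ n (λ x → h x * φ (M + x))                        ∎
  where
  expand : ∀ b p M x → (1 + b * p) * M + x ≡ b * (p * M) + (M + x)
  expand = solve-∀
  regroup : ∀ x → a * (q * M) + x ≡ b * (p * M) + (M + x)
  regroup x = begin
    a * (q * M) + x        ≡⟨ cong (_+ x) (*-assoc a q M) ⟨
    a * q * M + x          ≡⟨ cong (λ k → k * M + x) 1+bp≡aq ⟨
    (1 + b * p) * M + x    ≡⟨ expand b p M x ⟩
    b * (p * M) + (M + x)  ∎
... | Bézout.+- b a 1+aq≡bp = sym (begin
  ∑ n (λ x → h x * φ (M + x))                        ≡⟨ ∑-shift (periodic-* (periodic-∣ qM∣n perh) (periodic-shift M (periodic-∣ pM∣n perφ))) (a * (q * M)) ⟨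
  ∑ n (λ x → h (a * (q * M) + x) * φ (M + (a * (q * M) + x)))
    ≡⟨ ∑-cong n (λ x → cong₂ _*_ (periodic-multiple a perh x) (trans (cong φ (regroup x)) (periodic-multiple b perφ x))) ⟩
  ∑ n (λ x → h x * φ x)                              ∎)
  where
  expand : ∀ a q M x → M + (a * (q * M) + x) ≡ (1 + a * q) * M + x
  expand = solve-∀
  regroup : ∀ x → M + (a * (q * M) + x) ≡ b * (p * M) + x
  regroup x = begin
    M + (a * (q * M) + x)  ≡⟨ expand a q M x ⟩
    (1 + a * q) * M + x    ≡⟨ cong (λ k → k * M + x) 1+aq≡bp ⟩
    b * p * M + x          ≡⟨ cong (_+ x) (*-assoc b p M) ⟩
    b * (p * M) + x        ∎

-- Progressions of step `d` modulo `N`, and their ends.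

δ : ℕ → ℕ → ℕ
δ N x = if does (N ∣? x) then 1 else 0

∣⇒δ≡1 : ∀ {N x} → N ∣ x → δ N x ≡ 1
∣⇒δ≡1 {N} {x} N∣x with N ∣? x
... | yes _   = refl
... | no  N∤x = contradiction N∣x N∤x

∤⇒δ≡0 : ∀ {N x} → N ∤ x → δ N x ≡ 0
∤⇒δ≡0 {N} {x} N∤x with N ∣? x
... | yes N∣x = contradiction N∣x N∤x
... | no  _   = refl

δ-periodic : ∀ N → Periodic N (δ N)
δ-periodic N x with N ∣? x
... | yes N∣x = ∣⇒δ≡1 (∣m∣n⇒∣m+n ∣-refl N∣x)
... | no  N∤x = ∤⇒δ≡0 (λ N∣N+x → N∤x (∣m+n∣m⇒∣n N∣N+x ∣-refl))

-- The indicator function of { - j d : j < r } + N ℤ, counted with multiplicity.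
run : ℕ → ℕ → ℕ → ℕ → ℕ
run N d zero    x = 0
run N d (suc r) x = δ N x + run N d r (d + x)

run-periodic : ∀ N d r → Periodic N (run N d r)
run-periodic N d zero    x = refl
run-periodic N d (suc r) x = cong₂ _+_ (δ-periodic N x) (periodic-shift {f = run N d r} d (run-periodic N d r) x)

-- Passing from `x` to `d + x` drops the term `j = 0` of the run and gains the term `j = r`; the
-- difference of the two runs is written without subtraction.
run-telescope : ∀ N d r x → δ N x + run N d r (d + x) ≡ run N d r x + δ N (r * d + x)
run-telescope N d zero    x = +-identityʳ (δ N x)
run-telescope N d (suc r) x = begin
  δ N x + (δ N (d + x) + run N d r (d + (d + x)))          ≡⟨ cong (δ N x +_) (run-telescope N d r (d + x)) ⟩
  δ N x + (run N d r (d + x) + δ N (r * d + (d + x)))      ≡⟨ +-assoc (δ N x) _ _ ⟨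
  δ N x + run N d r (d + x) + δ N (r * d + (d + x))        ≡⟨ cong (λ y → run N d (suc r) x + δ N y) (rearrange r d x) ⟩
  run N d (suc r) x + δ N (suc r * d + x)                  ∎
  where
  rearrange : ∀ r d x → r * d + (d + x) ≡ (1 + r) * d + x
  rearrange = solve-∀

-- Serves to keep runs with different offsets modulo `d` apart.
run-∤ : ∀ {N d} r {x} → d ∣ N → d ∤ x → run N d r x ≡ 0
run-∤         zero    d∣N d∤x = refl
run-∤ {N} {d} (suc r) d∣N d∤x =
  cong₂ _+_ (∤⇒δ≡0 (d∤x ∘ ∣-trans d∣N)) (run-∤ r d∣N (λ d∣d+x → d∤x (∣m+n∣m⇒∣n d∣d+x ∣-refl)))

run-vanish : ∀ {N} d r x → (∀ j → j < r → N ∤ j * d + x) → run N d r x ≡ 0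
run-vanish d zero    x none = refl
run-vanish {N} d (suc r) x none = cong₂ _+_ (∤⇒δ≡0 (none 0 (s≤s z≤n)))
  (run-vanish d r (d + x) (λ j j<r → subst (N ∤_) (rearrange d j x) (none (suc j) (s≤s j<r))))
  where
  rearrange : ∀ d j x → (1 + j) * d + x ≡ j * d + (d + x)
  rearrange = solve-∀

-- Two hits would make `N` divide a positive multiple of `d` that is at most `(r - 1) d`, hence
-- smaller than `N`.
run≤1 : ∀ {N} d .{{_ : NonZero d}} r x → r * d ≤ N → run N d r x ≤ 1
run≤1     d       zero    x rd≤N = z≤n
run≤1 {N} d@(suc _) (suc r) x rd≤N with N ∣? x
... | no  _   = run≤1 d r (d + x) (≤-trans (m≤n+m (r * d) d) rd≤N)
... | yes N∣x = s≤s (≤-reflexive (run-vanish d r (d + x) none))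
  where
  rearrange : ∀ d j x → j * d + (d + x) ≡ x + (1 + j) * d
  rearrange = solve-∀
  none : ∀ j → j < r → N ∤ j * d + (d + x)
  none j j<r N∣ = >⇒∤ (<-≤-trans (*-monoˡ-< d (s≤s j<r)) rd≤N)
    (∣m+n∣m⇒∣n (subst (N ∣_) (rearrange d j x) N∣) N∣x)

-- The place where a progression of step `d` stops, read off from the values of `f` alone, so that a
-- translation carries peaks to peaks.
Peak : ℕ → (ℕ → ℕ) → ℕ → Set
Peak d f x = (f x ≡ 1) × (f (d + x) ≡ 0)

-- If `N ∤ x`, the telescoping identity at a peak has 0 on the left and at least 1 on the right.
run-peak⇒∣ : ∀ {N d} r {x} → Peak d (run N d r) x → N ∣ x
run-peak⇒∣ {N} {d} r {x} (x≡1 , dx≡0) with N ∣? x | run-telescope N d r x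
... | yes N∣x | _  = N∣x
... | no  _   | eq rewrite x≡1 | dx≡0 = contradiction eq 0≢1+n

-- The values of `δ N` at `x` and `r * d + x` are 1 and 0, so telescoping gives
-- `R x ≡ 1 + R (d + x)`, and the bound `run≤1` forces the values 1 and 0. Strictness of `r * d < N`
-- matters: at equality the run closes up into a cycle without an end.
∣⇒run-peak : ∀ {N} d .{{_ : NonZero d}} r → 0 < r → r * d < N → ∀ {x} → N ∣ x → Peak d (run N d r) x
∣⇒run-peak {N} d@(suc _) (suc r) _ rd<N {x} N∣x =
    trans telescoped (cong suc dx≡0) , dx≡0
  where
  R = run N d (suc r)
  N∤M+x : N ∤ suc r * d + x
  N∤M+x N∣ = >⇒∤ rd<N (∣m+n∣m⇒∣n (subst (N ∣_) (+-comm (suc r * d) x) N∣) N∣x)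
  telescoped : R x ≡ 1 + R (d + x)
  telescoped = sym (begin
    1 + R (d + x)               ≡⟨ cong (_+ R (d + x)) (∣⇒δ≡1 N∣x) ⟨
    δ N x + R (d + x)           ≡⟨ run-telescope N d (suc r) x ⟩
    R x + δ N (suc r * d + x)   ≡⟨ cong (R x +_) (∤⇒δ≡0 N∤M+x) ⟩
    R x + 0                     ≡⟨ +-identityʳ (R x) ⟩
    R x                         ∎)
  dx≡0 : R (d + x) ≡ 0
  dx≡0 = n≤0⇒n≡0 (≤-pred (subst (_≤ 1) telescoped (run≤1 d (suc r) x (<⇒≤ rd<N))))

-- By telescoping, the two runs differ only by a `δ` at `u + x` against one at `M + (u + x)`, and
-- `∑-coprime-shift` shows that `h` cannot tell these apart. The sum with `δ` is added to both sides
-- and cancelled.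
run-exchange : ∀ {p q} r d {n h} → Coprime p q → p * (r * d) ∣ n → q * (r * d) ∣ n →
               Periodic (q * (r * d)) h → ∀ u →
               ∑ n (λ x → h x * run (p * (r * d)) d r (u + x)) ≡
               ∑ n (λ x → h x * run (p * (r * d)) d r (d + (u + x)))
run-exchange {p} {q} r d {n} {h} cop N∣n qM∣n perh u = +-cancelʳ-≡ (∑ n (λ x → h x * D (u + x))) _ _ (begin
  ∑ n (λ x → h x * R (u + x)) + ∑ n (λ x → h x * D (u + x))
    ≡⟨ cong₂ _+_ refl (∑-coprime-shift M cop N∣n qM∣n perh (periodic-shift u (δ-periodic N))) ⟩
  ∑ n (λ x → h x * R (u + x)) + ∑ n (λ x → h x * D (u + (M + x)))
    ≡⟨ ∑-+ n _ _ ⟨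
  ∑ n (λ x → h x * R (u + x) + h x * D (u + (M + x)))
    ≡⟨ ∑-cong n pointwise ⟩
  ∑ n (λ x → h x * R (d + (u + x)) + h x * D (u + x))
    ≡⟨ ∑-+ n _ _ ⟩
  ∑ n (λ x → h x * R (d + (u + x))) + ∑ n (λ x → h x * D (u + x)) ∎)
  where
  M = r * d
  N = p * M
  R = run N d r
  D = δ N
  pointwise : ∀ x → h x * R (u + x) + h x * D (u + (M + x)) ≡ h x * R (d + (u + x)) + h x * D (u + x)
  pointwise x = begin
    h x * R (u + x) + h x * D (u + (M + x))  ≡⟨ *-distribˡ-+ (h x) _ _ ⟨
    h x * (R (u + x) + D (u + (M + x)))      ≡⟨ cong (λ y → h x * (R (u + x) + D y)) (swap-+ u M x) ⟩
    h x * (R (u + x) + D (M + (u + x)))      ≡⟨ cong (h x *_) (run-telescope N d r (u + x)) ⟨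
    h x * (D (u + x) + R (d + (u + x)))      ≡⟨ cong (h x *_) (+-comm (D (u + x)) _) ⟩
    h x * (R (d + (u + x)) + D (u + x))      ≡⟨ *-distribˡ-+ (h x) _ _ ⟩
    h x * R (d + (u + x)) + h x * D (u + x)  ∎

-- From subsets of the cyclic group to periodic functions on ℕ.

triple : (ℕ → ℕ) → ℕ → ℕ → ℕ → ℕ
triple k u v x = k x * k (u + x) * k (v + x)

support : ∀ {m} → (ℕ → ℕ) → Subsetℤ m
support f x = does (0 <? f (toℕ x))

toℕ-mod : ∀ n .{{_ : NonZero n}} x → toℕ (x mod n) ≡ x % n
toℕ-mod n x = toℕ-fromℕ< _

periodic-⊕ : ∀ {m f} → Periodic (suc m) f → ∀ (a b : Fin (suc m)) → f (toℕ (a ⊕ b)) ≡ f (toℕ a + toℕ b)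
periodic-⊕ {m} {f} per a b = trans (cong f (toℕ-mod (suc m) (toℕ a + toℕ b))) (periodic-% per (toℕ a + toℕ b))

𝟙-support : ∀ {m f} → (∀ x → f x ≤ 1) → ∀ (x : Fin (suc m)) → 𝟙 (support f) x ≡ f (toℕ x)
𝟙-support {m} {f} f≤1 x with f (toℕ x) | f≤1 (toℕ x)
... | 0 | _ = refl
... | 1 | _ = refl
... | suc (suc _) | s≤s ()

𝟙-cong : ∀ {m} (E F : Subsetℤ m) {x y} → E x ≡ F y → 𝟙 E x ≡ 𝟙 F y
𝟙-cong E F {x} {y} eq with E x | F y
𝟙-cong E F refl | true  | true  = refl
𝟙-cong E F refl | false | false = refl

-- Periodicity absorbs the reduction modulo `suc m` in `⊕`, which leaves ordinary addition.
deck3-∑ : ∀ {m f} → Periodic (suc m) f → (∀ x → f x ≤ 1) → ∀ (u v : Fin (suc m)) →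
          deck3 (𝟙 (support f)) u v ≡ ∑ (suc m) (triple f (toℕ u) (toℕ v))
deck3-∑ {m} {f} per f≤1 u v = ∑-tabulate (suc m) (triple f (toℕ u) (toℕ v)) _ (λ x →
  cong₂ _*_ (cong₂ _*_ (𝟙-support f≤1 x) (at-shift u x)) (at-shift v x))
  where
  at-shift : ∀ u x → 𝟙 (support f) (x ⊕ u) ≡ f (toℕ u + toℕ x)
  at-shift u x = begin
    𝟙 (support f) (x ⊕ u)  ≡⟨ 𝟙-support f≤1 (x ⊕ u) ⟩
    f (toℕ (x ⊕ u))        ≡⟨ periodic-⊕ per x u ⟩
    f (toℕ x + toℕ u)      ≡⟨ cong f (+-comm (toℕ x) (toℕ u)) ⟩
    f (toℕ u + toℕ x)      ∎

-- Equality of the decks.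

module Mixture
  (n p q r d : ℕ) (cop : Coprime p q)
  (pM∣n : p * (r * d) ∣ n) (qM∣n : q * (r * d) ∣ n)
  where

  M = r * d

  -- These count `W_q`, `W_p - 1`, `W_p - 1 - d` and the two unions. The offset 1 places `β` and
  -- `β′` in the class of -1 modulo `d`, while `α` lives on the multiples of `d`.
  α β β′ f g : ℕ → ℕ
  α x = run (q * M) d r x
  β x = run (p * M) d r (suc x)
  β′ x = run (p * M) d r (d + suc x)
  f x = α x + β x
  g x = α x + β′ x

  α-periodic : Periodic (q * M) α
  α-periodic = run-periodic (q * M) d r

  β-periodic : Periodic (p * M) β
  β-periodic = periodic-shift 1 (run-periodic (p * M) d r)

  β′-periodic : Periodic (p * M) β′
  β′-periodic x = trans (cong (run (p * M) d r ∘ (d +_)) (sym (+-suc (p * M) x)))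
    (periodic-shift d (run-periodic (p * M) d r) (suc x))

  f-periodic : Periodic n f
  f-periodic = periodic-+ (periodic-∣ qM∣n α-periodic) (periodic-∣ pM∣n β-periodic)

  g-periodic : Periodic n g
  g-periodic = periodic-+ (periodic-∣ qM∣n α-periodic) (periodic-∣ pM∣n β′-periodic)

  swap-β : ∀ {h} → Periodic (q * M) h → ∀ u → ∑ n (λ x → h x * β (u + x)) ≡ ∑ n (λ x → h x * β′ (u + x))
  -- The offset 1 is absorbed into the shift, since `suc u + x` computes to `suc (u + x)`.
  swap-β perh u = run-exchange r d cop pM∣n qM∣n perh (suc u)

  β′-shift : ∀ u x → β (u + (d + x)) ≡ β′ (u + x)
  β′-shift u x = cong (run (p * M) d r) (rearrange u d x)
    where
    rearrange : ∀ u d x → 1 + (u + (d + x)) ≡ d + (1 + (u + x))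
    rearrange = solve-∀

  -- Shifting both factors by d moves h onto h′, and α is then moved back by the exchange.
  swap-α : ∀ {h h′ : ℕ → ℕ} → Periodic (p * M) h → (∀ x → h (d + x) ≡ h′ x) → ∀ u →
           ∑ n (λ x → h x * α (u + x)) ≡ ∑ n (λ x → h′ x * α (u + x))
  swap-α {h} {h′} perh eq u = begin
    ∑ n (λ x → h x * α (u + x))
      ≡⟨ ∑-shift (periodic-* (periodic-∣ pM∣n perh) (periodic-shift u (periodic-∣ qM∣n α-periodic))) d ⟨
    ∑ n (λ x → h (d + x) * α (u + (d + x)))
      ≡⟨ ∑-cong n (λ x → cong (λ y → h (d + x) * α y) (swap-+ u d x)) ⟩
    ∑ n (λ x → h (d + x) * α (d + (u + x)))
      ≡⟨ run-exchange r d (Coprime.sym cop) qM∣n pM∣n (periodic-shift d perh) u ⟨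
    ∑ n (λ x → h (d + x) * α (u + x))
      ≡⟨ ∑-cong n (λ x → cong (_* α (u + x)) (eq x)) ⟩
    ∑ n (λ x → h′ x * α (u + x)) ∎

  infixl 6 _⊞_
  _⊞_ : {a b a′ b′ : ℕ → ℕ} → ∑ n a ≡ ∑ n a′ → ∑ n b ≡ ∑ n b′ →
        ∑ n (λ x → a x + b x) ≡ ∑ n (λ x → a′ x + b′ x)
  _⊞_ {a} {b} {a′} {b′} e₁ e₂ = trans (∑-+ n a b) (trans (cong₂ _+_ e₁ e₂) (sym (∑-+ n a′ b′)))

  -- Each mixed term has its odd factor last, in the shape `h x * φ (w + x)` that the two exchanges
  -- expect.
  expand : (k : ℕ → ℕ) (u v x : ℕ) → ℕ
  expand k u v x =
      triple α u v x
    + triple k u v x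
    + α x * α (u + x) * k (v + x)
    + α x * α (v + x) * k (u + x)
    + α (u + x) * α (v + x) * k x
    + k x * k (u + x) * α (v + x)
    + k x * k (v + x) * α (u + x)
    + k (u + x) * k (v + x) * α x

  triple-expand : ∀ k u v x → triple (λ y → α y + k y) u v x ≡ expand k u v x
  triple-expand k u v x = identity (α x) (α (u + x)) (α (v + x)) (k x) (k (u + x)) (k (v + x))
    where
    identity : ∀ a b c a′ b′ c′ → (a + a′) * (b + b′) * (c + c′) ≡
      a * b * c + a′ * b′ * c′ + a * b * c′ + a * c * b′ + b * c * a′ + a′ * b′ * c + a′ * c′ * b + b′ * c′ * a
    identity = solve-∀

  -- The pure `α` term is common to both sides and the pure `β` term is translated by `d`. A term
  -- with two factors `α` is handled by `swap-β`, one with two factors `β` by `swap-α`; the argument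
  -- 0 is for an odd factor at `x` itself.
  same-triples : ∀ u v → ∑ n (triple f u v) ≡ ∑ n (triple g u v)
  same-triples u v = begin
    ∑ n (triple f u v)   ≡⟨ ∑-cong n (triple-expand β u v) ⟩
    ∑ n (expand β u v)
      ≡⟨ refl {x = ∑ n (triple α u v)}
       ⊞ βββ
       ⊞ swap-β (periodic-* α-periodic (αₚ u)) v
       ⊞ swap-β (periodic-* α-periodic (αₚ v)) u
       ⊞ swap-β (periodic-* (αₚ u) (αₚ v)) 0
       ⊞ swap-α (periodic-* β-periodic (βₚ u)) (λ x → cong₂ _*_ (β′-shift 0 x) (β′-shift u x)) v
       ⊞ swap-α (periodic-* β-periodic (βₚ v)) (λ x → cong₂ _*_ (β′-shift 0 x) (β′-shift v x)) u
       ⊞ swap-α (periodic-* (βₚ u) (βₚ v)) (λ x → cong₂ _*_ (β′-shift u x) (β′-shift v x)) 0 ⟩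
    ∑ n (expand β′ u v)  ≡⟨ ∑-cong n (triple-expand β′ u v) ⟨
    ∑ n (triple g u v)   ∎
    where
    αₚ : ∀ w → Periodic (q * M) (λ x → α (w + x))
    αₚ w = periodic-shift w α-periodic
    βₚ : ∀ w → Periodic (p * M) (λ x → β (w + x))
    βₚ w = periodic-shift w β-periodic
    βββ : ∑ n (triple β u v) ≡ ∑ n (triple β′ u v)
    βββ = begin
      ∑ n (triple β u v)
        ≡⟨ ∑-shift (periodic-∣ pM∣n (periodic-* (periodic-* β-periodic (βₚ u)) (βₚ v))) d ⟨
      ∑ n (λ x → triple β u v (d + x))
        ≡⟨ ∑-cong n (λ x → cong₂ _*_ (cong₂ _*_ (β′-shift 0 x) (β′-shift u x)) (β′-shift v x)) ⟩
      ∑ n (triple β′ u v) ∎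

-- The two sets, and why they are not translates.

module Construction
  (m p q r d : ℕ) (cop : Coprime p q)
  (1<p : 1 < p) (1<q : 1 < q) (1<r : 1 < r) (1<d : 1 < d)
  (pM∣n : p * (r * d) ∣ suc m) (qM∣n : q * (r * d) ∣ suc m)
  where

  n = suc m

  open Mixture n p q r d cop pM∣n qM∣n

  instance
    d≢0 : NonZero d
    d≢0 = >-nonZero (<-trans (s≤s z≤n) 1<d)
    M≢0 : NonZero M
    M≢0 = >-nonZero (*-mono-< {0} {r} {0} {d} (<-trans (s≤s z≤n) 1<r) (<-trans (s≤s z≤n) 1<d))

  0<r : 0 < r
  0<r = <-trans (s≤s z≤n) 1<r

  M<k*M : ∀ {k} → 1 < k → M < k * M
  M<k*M {k} 1<k = subst (_< k * M) (*-identityˡ M) (*-monoˡ-< M 1<k)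

  d∣k*M : ∀ k → d ∣ k * M
  d∣k*M k = ∣-trans (n∣m*n r) (n∣m*n k)

  d∤1 : d ∤ 1
  d∤1 = >⇒∤ 1<d

  ∣x⇒∤1+x : ∀ {x} → d ∣ x → d ∤ suc x
  ∣x⇒∤1+x {x} d∣x d∣1+x = d∤1 (∣m+n∣m⇒∣n (subst (d ∣_) (+-comm 1 x) d∣1+x) d∣x)

  ∣d+x⇒∣x : ∀ {x} → d ∣ d + x → d ∣ x
  ∣d+x⇒∣x d∣d+x = ∣m+n∣m⇒∣n d∣d+x ∣-refl

  ∤x⇒∤d+x : ∀ {x} → d ∤ x → d ∤ d + x
  ∤x⇒∤d+x d∤x = d∤x ∘ ∣d+x⇒∣x

  ∤⇒α≡0 : ∀ {x} → d ∤ x → α x ≡ 0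
  ∤⇒α≡0 = run-∤ r (d∣k*M q)

  ∤⇒β≡0 : ∀ {x} → d ∤ suc x → β x ≡ 0
  ∤⇒β≡0 = run-∤ r (d∣k*M p)

  ∤⇒β′≡0 : ∀ {x} → d ∤ suc x → β′ x ≡ 0
  ∤⇒β′≡0 d∤1+x = run-∤ r (d∣k*M p) (∤x⇒∤d+x d∤1+x)

  ∣⇒∤1+d+ : ∀ {x} → d ∣ x → d ∤ suc (d + x)
  ∣⇒∤1+d+ d∣x = ∣x⇒∤1+x (∣m∣n⇒∣m+n ∣-refl d∣x)

  α≤1 : ∀ x → α x ≤ 1
  α≤1 x = run≤1 d r x (<⇒≤ (M<k*M 1<q))

  -- The classes of 0 and -1 modulo `d` differ because `1 < d`, so at most one summand is nonzero at
  -- `x`.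
  f≤1 : ∀ x → f x ≤ 1
  f≤1 x with d ∣? x
  ... | yes d∣x rewrite ∤⇒β≡0 (∣x⇒∤1+x d∣x) | +-identityʳ (α x) = α≤1 x
  ... | no  d∤x rewrite ∤⇒α≡0 d∤x = run≤1 d r (suc x) (<⇒≤ (M<k*M 1<p))

  g≤1 : ∀ x → g x ≤ 1
  g≤1 x with d ∣? x
  ... | yes d∣x rewrite ∤⇒β′≡0 (∣x⇒∤1+x d∣x) | +-identityʳ (α x) = α≤1 x
  ... | no  d∤x rewrite ∤⇒α≡0 d∤x = run≤1 d r (d + suc x) (<⇒≤ (M<k*M 1<p))

  -- Both `x` and `d + x` are multiples of `d`, where `β` vanishes, so the peak of `α` survives in
  -- `f`.
  f-peak-α : ∀ {x} → q * M ∣ x → Peak d f x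
  f-peak-α {x} qM∣x = cong₂ _+_ (proj₁ peak) (∤⇒β≡0 (∣x⇒∤1+x d∣x)) , cong₂ _+_ (proj₂ peak) (∤⇒β≡0 (∣⇒∤1+d+ d∣x))
    where
    peak = ∣⇒run-peak d r 0<r (M<k*M 1<q) qM∣x
    d∣x = ∣-trans (d∣k*M q) qM∣x

  f-peak-β : ∀ {x} → p * M ∣ suc x → Peak d f x
  f-peak-β {x} pM∣1+x =
      cong₂ _+_ (∤⇒α≡0 d∤x) (proj₁ peak)
    , cong₂ _+_ (∤⇒α≡0 (∤x⇒∤d+x d∤x)) (trans (cong (run (p * M) d r) (sym (+-suc d x))) (proj₂ peak))
    where
    peak = ∣⇒run-peak d r 0<r (M<k*M 1<p) pM∣1+x
    d∤x : d ∤ x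
    d∤x d∣x = ∣x⇒∤1+x d∣x (∣-trans (d∣k*M p) pM∣1+x)

  -- The residue of `x` modulo `d` decides which progression stops there: `β′` vanishes at `x`, and
  -- `g (d + x) ≡ 0` forces both summands to be 0.
  g-peak-∣ : ∀ {x} → Peak d g x → d ∣ x → q * M ∣ x
  g-peak-∣ {x} (gx≡1 , gdx≡0) d∣x = run-peak⇒∣ r (trans αx≡gx gx≡1 , m+n≡0⇒m≡0 _ gdx≡0)
    where
    αx≡gx : α x ≡ g x
    αx≡gx = sym (trans (cong (α x +_) (∤⇒β′≡0 (∣x⇒∤1+x d∣x))) (+-identityʳ (α x)))

  g-peak-∤ : ∀ {x} → Peak d g x → d ∤ x → p * M ∣ d + suc x
  g-peak-∤ {x} (gx≡1 , gdx≡0) d∤x = run-peak⇒∣ r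
    ( trans (sym (cong (_+ β′ x) (∤⇒α≡0 d∤x))) gx≡1
    , trans (cong (run (p * M) d r ∘ (d +_)) (+-suc d x)) (m+n≡0⇒n≡0 (α (d + x)) gdx≡0))

  p∤q : p ∤ q
  p∤q p∣q = <-irrefl (sym (cop (∣-refl , p∣q))) 1<p

  peak-move : ∀ {t x} → (∀ x → g (t + x) ≡ f x) → Peak d f x → Peak d g (t + x)
  peak-move {t} {x} g∘t≗f (fx≡1 , fdx≡0) =
    trans (g∘t≗f x) fx≡1 , trans (cong g (swap-+ d t x)) (trans (g∘t≗f (d + x)) fdx≡0)

  -- If d ∣ t, the peaks at 0 and m ≡ - 1 (mod n) make t ≡ 0 and t + d ≡ 0 modulo M;
  -- otherwise the peaks at 0 and q M make q M a multiple of p M.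
  f-g-not-shifted : ∀ t → ¬ (∀ x → g (t + x) ≡ f x)
  f-g-not-shifted t g∘t≗f with d ∣? t
  ... | yes d∣t = >⇒∤ d<M (∣m+n∣m⇒∣n M∣t+n+d M∣t+n)
    where
    move : ∀ {x} → Peak d f x → Peak d g (t + x)
    move = peak-move g∘t≗f
    d<M : d < M
    d<M = subst (_< M) (*-identityˡ d) (*-monoˡ-< d 1<r)
    d∤t+m : d ∤ t + m
    d∤t+m d∣t+m = ∣x⇒∤1+x (∣m+n∣m⇒∣n d∣t+m d∣t) (∣-trans (d∣k*M p) pM∣n)
    -- The multiple `n` of `M` is added so that this differs by exactly `d` from what the peak at
    -- `m = n - 1` yields.
    M∣t+n : M ∣ t + n
    M∣t+n = ∣m∣n⇒∣m+n
      (∣-trans (n∣m*n q) (subst (q * M ∣_) (+-identityʳ t)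
        (g-peak-∣ (move (f-peak-α ((q * M) ∣0))) (subst (d ∣_) (sym (+-identityʳ t)) d∣t))))
      (∣-trans (n∣m*n p) pM∣n)
    rearrange : ∀ d t m → d + (1 + (t + m)) ≡ t + (1 + m) + d
    rearrange = solve-∀
    M∣t+n+d : M ∣ t + n + d
    M∣t+n+d = ∣-trans (n∣m*n p) (subst (p * M ∣_) (rearrange d t m)
      (g-peak-∤ (move (f-peak-β pM∣n)) d∤t+m))
  ... | no d∤t = p∤q (*-cancelʳ-∣ M (∣m+n∣m⇒∣n
    (subst (p * M ∣_) (rearrange d t (q * M)) (g-peak-∤ (move (f-peak-α ∣-refl)) d∤t+qM))
    (g-peak-∤ (move (f-peak-α ((q * M) ∣0))) (subst (d ∤_) (sym (+-identityʳ t)) d∤t))))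
    where
    move : ∀ {x} → Peak d f x → Peak d g (t + x)
    move = peak-move g∘t≗f
    d∤t+qM : d ∤ t + q * M
    d∤t+qM d∣t+qM = d∤t (∣m+n∣m⇒∣n (subst (d ∣_) (+-comm t (q * M)) d∣t+qM) (d∣k*M q))
    rearrange : ∀ d t c → d + (1 + (t + c)) ≡ d + (1 + (t + 0)) + c
    rearrange = solve-∀

  E F : Subsetℤ m
  E = support f
  F = support g

  E-F-not-translate : ¬ IsTranslate E F
  E-F-not-translate (t , F⊕t≗E) = f-g-not-shifted (toℕ t) shifted
    where
    shifted-Fin : ∀ x → g (toℕ t + toℕ x) ≡ f (toℕ x)
    shifted-Fin x = begin
      g (toℕ t + toℕ x)  ≡⟨ cong g (+-comm (toℕ t) (toℕ x)) ⟩
      g (toℕ x + toℕ t)  ≡⟨ periodic-⊕ g-periodic x t ⟨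
      g (toℕ (x ⊕ t))    ≡⟨ 𝟙-support g≤1 (x ⊕ t) ⟨
      𝟙 F (x ⊕ t)        ≡⟨ 𝟙-cong F E (F⊕t≗E x) ⟩
      𝟙 E x              ≡⟨ 𝟙-support f≤1 x ⟩
      f (toℕ x)          ∎
    -- Both sides are `n`-periodic in `x`, so the identity on residues extends to all of ℕ, where
    -- peaks are compared.
    shifted : ∀ x → g (toℕ t + x) ≡ f x
    shifted x = begin
      g (toℕ t + x)              ≡⟨ periodic-% (periodic-shift (toℕ t) g-periodic) x ⟨
      g (toℕ t + x % n)          ≡⟨ cong (λ y → g (toℕ t + y)) (toℕ-mod n x) ⟨
      g (toℕ t + toℕ (x mod n))  ≡⟨ shifted-Fin (x mod n) ⟩
      f (toℕ (x mod n))          ≡⟨ cong f (toℕ-mod n x) ⟩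
      f (x % n)                  ≡⟨ periodic-% f-periodic x ⟩
      f x                        ∎

  E-F-same-deck : SameDeck3 E F
  E-F-same-deck u v = begin
    deck3 (𝟙 E) u v                     ≡⟨ deck3-∑ f-periodic f≤1 u v ⟩
    ∑ n (triple f (toℕ u) (toℕ v))      ≡⟨ same-triples (toℕ u) (toℕ v) ⟩
    ∑ n (triple g (toℕ u) (toℕ v))      ≡⟨ deck3-∑ g-periodic g≤1 u v ⟨
    deck3 (𝟙 F) u v                     ∎

-- Specialisation to two distinct primes.

distinct-primes⇒coprime : ∀ {p q} → Prime p → Prime q → p ≢ q → Coprime p q
distinct-primes⇒coprime pp pq p≢q (i∣p , i∣q) with prime⇒irreducible pp i∣p | prime⇒irreducible pq i∣q
... | inj₁ i≡1 | _        = i≡1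
... | inj₂ _   | inj₁ i≡1 = i≡1
... | inj₂ i≡p | inj₂ i≡q = contradiction (trans (sym i≡p) i≡q) p≢q

prime⇒>1 : ∀ {p} → Prime p → 1 < p
prime⇒>1 {p} pp = nonTrivial⇒n>1 p {{prime⇒nonTrivial pp}}

theorem3 : (m p q r d : ℕ) → Prime p → Prime q → p ≢ q → 1 < r → 1 < d → suc m ≡ p * q * r * d → Σ (Subsetℤ m) (λ E → Σ (Subsetℤ m) (λ F → (¬ IsTranslate E F) × SameDeck3 E F))
theorem3 m p q r d pp pq p≢q 1<r 1<d n≡pqrd = E , F , E-F-not-translate , E-F-same-deck
  where
  factor-p : ∀ p q r d → p * q * r * d ≡ q * (p * (r * d))
  factor-p = solve-∀
  factor-q : ∀ p q r d → p * q * r * d ≡ p * (q * (r * d))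
  factor-q = solve-∀
  open Construction m p q r d (distinct-primes⇒coprime pp pq p≢q) (prime⇒>1 pp) (prime⇒>1 pq) 1<r 1<d
    (divides q (trans n≡pqrd (factor-p p q r d))) (divides p (trans n≡pqrd (factor-q p q r d)))
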